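{- Let $w$ be a universal Lyndon word of degree $n$, let $s$ be a word and $a\in\Sigma_n\setminus\mathrm{alp}(s)$ a letter such that $asa$ is a cyclic factor of $w$. Then $bsb$ is a cyclic factor of $w$ for every $b\in\Sigma_n\setminus\mathrm{alp}(s)$.
   Context: $\Sigma_n=\{1,\ldots,n\}$. For a word $w=a_1\cdots a_m$ a proper conjugate is $w_2w_1$ where $w=w_1w_2$ with $w_1,w_2$ nonempty. A total order on the alphabet induces the lexicographic order on words ($u$ is smaller than $v$ if $u$ is a proper prefix of $v$, or $u=zau'$, $v=zbv'$ with letters $a<b$). A word $w$ over $\Sigma_n$ is a Lyndon word if for some total order on $\Sigma_n$ it is strictly lexicographically smaller than each of its proper conjugates. A universal Lyndon word of degree $n$ is a word over $\Sigma_n$ of length $n!$ all of whose conjugates are Lyndon words. A cyclic factor of $w$ is a nonempty word $u$ with $|u|\le|w|$ that is a factor of $ww$. $\mathrm{alp}(s)$ is the set of letters occurring in $s$ (the word $s$ may be empty). -}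

module Defs where

open import Level using (0ℓ)
open import Data.Nat using (ℕ; _≤_; _!)

open import Data.Fin using (Fin)
open import Data.List using (List; []; _∷_; _++_; length)
open import Data.Product using (Σ; ∃; ∃-syntax; _×_)
open import Relation.Binary.Core using (Rel)
open import Relation.Binary.Structures using (IsStrictTotalOrder)
open import Relation.Binary.PropositionalEquality using (_≡_)
open import Relation.Nullary using (¬_)

Word : ℕ → Set
Word n = List (Fin n)

data Lex {n : ℕ} (_<_ : Rel (Fin n) 0ℓ) : Word n → Word n → Set where
  prefix : ∀ {b v} → Lex _<_ [] (b ∷ v)
  here   : ∀ {a b u v} → a < b → Lex _<_ (a ∷ u) (b ∷ v)
  there  : ∀ {a u v} → Lex _<_ u v → Lex _<_ (a ∷ u) (a ∷ v)

LyndonFor : {n : ℕ} → Rel (Fin n) 0ℓ → Word n → Set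
LyndonFor _<_ w = ∀ w₁ w₂ → ¬ (w₁ ≡ []) → ¬ (w₂ ≡ []) → w ≡ w₁ ++ w₂ → Lex _<_ w (w₂ ++ w₁)

IsLyndon : {n : ℕ} → Word n → Set₁
IsLyndon {n} w = Σ (Rel (Fin n) 0ℓ) λ _<_ → IsStrictTotalOrder _≡_ _<_ × LyndonFor _<_ w

IsUniversalLyndon : (n : ℕ) → Word n → Set₁
IsUniversalLyndon n w = (length w ≡ n !) × (∀ w₁ w₂ → w ≡ w₁ ++ w₂ → IsLyndon (w₂ ++ w₁))

CyclicFactor : {n : ℕ} → Word n → Word n → Set
CyclicFactor u w = ¬ (u ≡ []) × (length u ≤ length w) × (∃[ x ] ∃[ y ] (w ++ w ≡ x ++ u ++ y))

-- Let w_i be the conjugate of w starting at position i, and <_i an order for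
-- which it is Lyndon.  Distinct conjugates have distinct orders, so, there being
-- n! of each, every order is some <_i.  If c is the letter at position i, moving
-- c to the front of <_{i+1} gives an order for which w_i is still least, hence
-- gives <_i.  So <_i lists the letters in the order of their first occurrence
-- in w_i, and a factor s occurs at i exactly when <_i starts with the first
-- occurrences p of s.
--
-- If c ∈ s and cs occurs, then s is always preceded by c.  As asa occurs and a ∉ s,
-- every occurrence of s is therefore preceded by a letter c ∉ s, and every
-- occurrence of sa by a.  When <_y = c p τ, the order p c τ belongs to another
-- occurrence of s; this injective map on the occurrences of s is onto, so some y
-- has <_y = b p a ρ, and bs occurs at y.  Comparing with asa and with <_y, the
-- next letter can only be a or b, and a is excluded because sa is always preceded by a.

module Submission where

open import Defs
open import Data.Nat using (ℕ)
open import Data.Fin using (Fin)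
open import Data.List using (List; _∷_; _++_; [_])
open import Data.List.Membership.Propositional using (_∉_)

open import Level using (0ℓ)
open import Data.Nat using (zero; suc; pred; _+_; _*_; _∸_; _≤_; _<_; s≤s; s≤s⁻¹; _!; NonZero)
open import Data.Nat.Properties as ℕ using (_!≢0)
open import Data.Nat.DivMod using (_%_; m%n<n; m%n%n≡m%n; [m+n]%n≡m%n; m<n⇒m%n≡m; %-distribˡ-+)
open import Data.Fin using (toℕ; fromℕ<)
open import Data.Fin.Properties using (_≟_; toℕ<n; toℕ-injective; toℕ-fromℕ<; fromℕ<-cong; fromℕ<-injective; pigeonhole)
open import Data.List using ([]; length; map; concatMap; filter; lookup; tabulate; allFin)
open import Data.List.Properties
  using (length-++; length-map; length-tabulate; filter-++; filter-all; filter-accept; filter-reject;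
         ++-assoc; ++-cancelˡ; ∷-injectiveˡ; ∷-injectiveʳ)
open import Data.List.Membership.Propositional using (_∈_; find)
open import Data.List.Membership.Propositional.Properties
open import Data.List.Relation.Binary.Permutation.Propositional using (_↭_; ↭-sym; ↭-trans; ↭-refl; ↭-reflexive; ↭⇒↭ₛ)
open import Data.List.Relation.Binary.Permutation.Propositional.Properties
  using (∈-resp-↭; shift; drop-mid; ++⁺ˡ; ↭-length; ↭-empty-inv)
import Data.List.Relation.Binary.Permutation.Setoid.Properties as Permutation
import Data.List.Sort as Sort
open import Data.List.Relation.Unary.All as All using (All; []; _∷_)
open import Data.List.Relation.Unary.AllPairs using (AllPairs; []; _∷_)
open import Data.List.Relation.Unary.Any as Any using (here; there)
open import Data.List.Relation.Unary.Linked.Properties using (Linked⇒AllPairs)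
open import Data.List.Relation.Unary.Unique.Propositional using (Unique)
open import Data.List.Relation.Unary.Unique.Propositional.Properties using (tabulate⁺; allFin⁺)
open import Data.Product using (∃; ∃-syntax; ∃₂; _×_; _,_; proj₁; proj₂)
open import Data.Sum using (_⊎_; inj₁; inj₂)
open import Data.Unit using (⊤; tt)
open import Function using (_∘_)
open import Relation.Binary.Bundles using (DecTotalOrder)
open import Relation.Binary.Core using (Rel)
open import Relation.Binary.Definitions using (Irreflexive)
open import Relation.Binary.Structures using (IsStrictTotalOrder)
open import Relation.Binary.PropositionalEquality hiding ([_])
import Relation.Binary.Properties.StrictTotalOrder as STO
open import Relation.Nullary using (¬_; yes; no; ¬?; contradiction)

private
  variable
    n : ℕ
    A : Set

-- Lists without repetitions

unique-resp-↭ : {xs ys : List A} → xs ↭ ys → Unique xs → Unique ys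
unique-resp-↭ p = Permutation.Unique-resp-↭ (setoid _) (↭⇒↭ₛ p)

unique-++ʳ : (l : List A) {r : List A} → Unique (l ++ r) → Unique r
unique-++ʳ [] u = u
unique-++ʳ (_ ∷ l) (_ ∷ u) = unique-++ʳ l u

-- Finite counting

-- Deleting the head of `xs` from both lists shortens each by one, so the length bound survives the
-- induction. This is how injectivity of `order` will yield its surjectivity.
unique-⊆-⊇ : {xs ys : List A} → Unique xs → (∀ {x} → x ∈ xs → x ∈ ys) →
             length ys ≤ length xs → ∀ {y} → y ∈ ys → y ∈ xs
unique-⊆-⊇ {ys = []} _ _ _ ()
unique-⊆-⊇ {xs = []} {ys = _ ∷ _} _ _ () _
unique-⊆-⊇ {xs = x ∷ xs} (x∉xs ∷ uxs) xs⊆ys len y∈ys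
  with l , r , refl ← ∈-∃++ (xs⊆ys (here refl))
  with ∈-resp-↭ (shift x l r) y∈ys
... | here y≡x = here y≡x
... | there y∈lr = there (unique-⊆-⊇ uxs xs⊆lr len′ y∈lr)
  where
  xs⊆lr : ∀ {z} → z ∈ xs → z ∈ l ++ r
  xs⊆lr z∈xs with ∈-resp-↭ (shift x l r) (xs⊆ys (there z∈xs))
  ... | here refl = contradiction refl (All.lookup x∉xs z∈xs)
  ... | there z∈lr = z∈lr
  len′ : length (l ++ r) ≤ length xs
  len′ = s≤s⁻¹ (subst (_≤ suc (length xs)) (↭-length (shift x l r)) len)

insertions : A → List A → List (List A)
insertions x [] = [ [ x ] ]
insertions x (y ∷ ys) = (x ∷ y ∷ ys) ∷ map (y ∷_) (insertions x ys)

permutations : List A → List (List A)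
permutations [] = [ [] ]
permutations (x ∷ xs) = concatMap (insertions x) (permutations xs)

length-insertions : (x : A) (ys : List A) → length (insertions x ys) ≡ suc (length ys)
length-insertions x [] = refl
length-insertions x (y ∷ ys) =
  cong suc (trans (length-map (y ∷_) (insertions x ys)) (length-insertions x ys))

∈-insertions : (x : A) (l r : List A) → l ++ x ∷ r ∈ insertions x (l ++ r)
∈-insertions x [] [] = here refl
∈-insertions x [] (y ∷ r) = here refl
∈-insertions x (y ∷ l) r = there (∈-map⁺ (y ∷_) (∈-insertions x l r))

insertions-↭ : (x : A) (ys : List A) {zs : List A} → zs ∈ insertions x ys → zs ↭ x ∷ ys
insertions-↭ x [] (here refl) = ↭-refl
insertions-↭ x (y ∷ ys) (here refl) = ↭-refl
insertions-↭ x (y ∷ ys) (there p) with zs , q , refl ← ∈-map⁻ (y ∷_) p =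
  ↭-trans (_↭_.prep y (insertions-↭ x ys q)) (_↭_.swap y x ↭-refl)

permutations-length : (xs : List A) {σ : List A} → σ ∈ permutations xs → length σ ≡ length xs
permutations-length [] (here refl) = refl
permutations-length (x ∷ xs) p =
  let τ , τ∈ , σ∈ = find (∈-concatMap⁻ (insertions x) {xs = permutations xs} p)
  in trans (↭-length (insertions-↭ x τ σ∈)) (cong suc (permutations-length xs τ∈))

length-concatMap : {B : Set} (g : A → List B) (xs : List A) {k : ℕ} →
                   (∀ {x} → x ∈ xs → length (g x) ≡ k) → length (concatMap g xs) ≡ length xs * k
length-concatMap g [] _ = refl
length-concatMap g (x ∷ xs) len =
  trans (length-++ (g x)) (cong₂ _+_ (len (here refl)) (length-concatMap g xs (len ∘ there)))

length-permutations : (xs : List A) → length (permutations xs) ≡ length xs !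
length-permutations [] = refl
length-permutations (x ∷ xs) = begin
  length (concatMap (insertions x) (permutations xs))  ≡⟨ length-concatMap (insertions x) (permutations xs)
      (λ {σ} σ∈ → trans (length-insertions x σ) (cong suc (permutations-length xs σ∈))) ⟩
  length (permutations xs) * suc (length xs)           ≡⟨ cong (_* suc (length xs)) (length-permutations xs) ⟩
  length xs ! * suc (length xs)                        ≡⟨ ℕ.*-comm (length xs !) (suc (length xs)) ⟩
  suc (length xs) * length xs !                        ∎
  where open ≡-Reasoning

-- The head `x` occurs somewhere in `σ`; what is left after deleting it there permutes `xs`, and
-- `insertions` puts it back in that place.
∈-permutations : (xs : List A) {σ : List A} → σ ↭ xs → σ ∈ permutations xs
∈-permutations [] p with refl ← ↭-empty-inv p = here refl
∈-permutations (x ∷ xs) p with l , r , refl ← ∈-∃++ (∈-resp-↭ (↭-sym p) (here refl)) =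
  ∈-concatMap⁺ (insertions x) {xs = permutations xs}
    (Any.map (λ { refl → ∈-insertions x l r }) (∈-permutations xs (drop-mid l [] p)))

-- The finite set is `A` modulo `class`, and the map on it is given as a relation between
-- representatives; hence injectivity speaks of classes.
module _ {N : ℕ} (class : A → Fin N) (S : A → Set) (_⟶_ : A → A → Set)
  (step : ∀ x → S x → ∃[ y ] (S y × x ⟶ y))
  (step-injective : ∀ {x x′ y y′} → x ⟶ y → x′ ⟶ y′ → class y ≡ class y′ → class x ≡ class x′)
  where

  private
    orbit : ∀ x → S x → ℕ → ∃ S
    orbit x Sx zero = x , Sx
    orbit x Sx (suc k) =
      let y , Sy = orbit x Sx k
          z , Sz , _ = step y Sy
      in z , Sz

    orbit-step : ∀ x (Sx : S x) k → proj₁ (orbit x Sx k) ⟶ proj₁ (orbit x Sx (suc k))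
    orbit-step x Sx k = let y , Sy = orbit x Sx k in proj₂ (proj₂ (step y Sy))

    -- Injectivity cancels one step at a time at both indices until the smaller one is 0. The orbit
    -- point just before the other index is then a predecessor of `x`.
    predecessor-at : ∀ x (Sx : S x) i j → i < j →
      class (proj₁ (orbit x Sx i)) ≡ class (proj₁ (orbit x Sx j)) →
      ∃₂ λ y z → S y × y ⟶ z × class z ≡ class x
    predecessor-at x Sx zero (suc j) _ eq =
      _ , _ , proj₂ (orbit x Sx j) , orbit-step x Sx j , sym eq
    predecessor-at x Sx (suc i) (suc j) (s≤s i<j) eq =
      predecessor-at x Sx i j i<j (step-injective (orbit-step x Sx i) (orbit-step x Sx j) eq)

  -- An injective self-map of a finite set is onto: an orbit must return to its starting point.
  predecessor : ∀ x → S x → ∃₂ λ y z → S y × y ⟶ z × class z ≡ class x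
  predecessor x Sx =
    -- The orbit points with indices 0 to `N` are `N + 1` in number and fall into `N` classes.
    let i , j , i<j , eq = pigeonhole ℕ.≤-refl (λ (k : Fin (suc N)) → class (proj₁ (orbit x Sx (toℕ k))))
    in predecessor-at x Sx (toℕ i) (toℕ j) i<j eq

-- Orders as lists

-- A list without repetitions encodes a strict total order of its entries, smallest first.
data Before {A : Set} : List A → A → A → Set where
  first : ∀ {x y l} → y ∈ l → Before (x ∷ l) x y
  later : ∀ {x y z l} → Before l x y → Before (z ∷ l) x y

before-∈ˡ : {l : List A} {x y : A} → Before l x y → x ∈ l
before-∈ˡ (first _) = here refl
before-∈ˡ (later p) = there (before-∈ˡ p)

before-∈ʳ : {l : List A} {x y : A} → Before l x y → y ∈ l
before-∈ʳ (first q) = there q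
before-∈ʳ (later p) = there (before-∈ʳ p)

before-asym : {l : List A} {x y : A} → Unique l → Before l x y → ¬ Before l y x
before-asym (x∉ ∷ _) (first p) (first _) = All.lookup x∉ p refl
before-asym (x∉ ∷ _) (first _) (later q) = All.lookup x∉ (before-∈ʳ q) refl
before-asym (x∉ ∷ _) (later p) (first _) = All.lookup x∉ (before-∈ʳ p) refl
before-asym (_ ∷ u) (later p) (later q) = before-asym u p q

before-irrefl : {l : List A} {x : A} → Unique l → ¬ Before l x x
before-irrefl u p = before-asym u p p

before-++ˡ : {p : List A} (l : List A) {x y : A} → Before p x y → Before (p ++ l) x y
before-++ˡ l (first q) = first (∈-++⁺ˡ q)
before-++ˡ l (later q) = later (before-++ˡ l q)

before-++⁻ˡ : (p : List A) {l : List A} {x y : A} → Unique (p ++ l) → y ∈ p →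
              Before (p ++ l) x y → Before p x y
before-++⁻ˡ (z ∷ p) (z∉ ∷ _) (here refl) (first q) = contradiction refl (All.lookup z∉ q)
before-++⁻ˡ (z ∷ p) (z∉ ∷ _) (here refl) (later q) = contradiction refl (All.lookup z∉ (before-∈ʳ q))
before-++⁻ˡ (z ∷ p) _ (there y∈p) (first q) = first y∈p
before-++⁻ˡ (z ∷ p) (_ ∷ u) (there y∈p) (later q) = later (before-++⁻ˡ p u y∈p q)

before-++⁻ʳ : (p : List A) {l : List A} {x y : A} → x ∉ p → Before (p ++ l) x y → Before l x y
before-++⁻ʳ [] _ q = q
before-++⁻ʳ (z ∷ p) x∉ (first _) = contradiction (here refl) x∉
before-++⁻ʳ (z ∷ p) x∉ (later q) = before-++⁻ʳ p (x∉ ∘ there) q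

before-++⁺ : {p l : List A} {x y : A} → x ∈ p → y ∈ l → Before (p ++ l) x y
before-++⁺ {p = _ ∷ p} (here refl) y∈l = first (∈-++⁺ʳ p y∈l)
before-++⁺ (there x∈p) y∈l = later (before-++⁺ x∈p y∈l)

before-total : {l : List A} {x y : A} → x ∈ l → y ∈ l → x ≢ y → Before l x y ⊎ Before l y x
before-total (here refl) (here refl) x≢y = contradiction refl x≢y
before-total (here refl) (there q) _ = inj₁ (first q)
before-total (there p) (here refl) _ = inj₂ (first p)
before-total (there p) (there q) x≢y with before-total p q x≢y
... | inj₁ r = inj₁ (later r)
... | inj₂ r = inj₂ (later r)

-- Moving a letter to the front, and first occurrences

infixl 6 _∖_

_∖_ : List (Fin n) → Fin n → List (Fin n)
l ∖ c = filter (λ x → ¬? (x ≟ c)) l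

∈-∖⁺ : {l : List (Fin n)} {c x : Fin n} → x ∈ l → x ≢ c → x ∈ l ∖ c
∈-∖⁺ {c = c} = ∈-filter⁺ (λ x → ¬? (x ≟ c))

∈-∖⁻ : {l : List (Fin n)} {c x : Fin n} → x ∈ l ∖ c → x ∈ l × x ≢ c
∈-∖⁻ {c = c} = ∈-filter⁻ (λ x → ¬? (x ≟ c))

++-∖ : (l r : List (Fin n)) (c : Fin n) → (l ++ r) ∖ c ≡ l ∖ c ++ r ∖ c
++-∖ l r c = filter-++ (λ x → ¬? (x ≟ c)) l r

∷-∖-≡ : (c : Fin n) (l : List (Fin n)) → (c ∷ l) ∖ c ≡ l ∖ c
∷-∖-≡ c l = filter-reject (λ x → ¬? (x ≟ c)) (λ c≢c → c≢c refl)

∷-∖-≢ : {x c : Fin n} (l : List (Fin n)) → x ≢ c → (x ∷ l) ∖ c ≡ x ∷ l ∖ c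
∷-∖-≢ {c = c} l = filter-accept (λ x → ¬? (x ≟ c))

∖-∉ : {l : List (Fin n)} {c : Fin n} → c ∉ l → l ∖ c ≡ l
∖-∉ {c = c} c∉l = filter-all (λ x → ¬? (x ≟ c)) (All.tabulate (λ { x∈l refl → c∉l x∈l }))

before-∖ : {l : List (Fin n)} {c x y : Fin n} → x ≢ c → y ≢ c → Before l x y → Before (l ∖ c) x y
before-∖ {l = x ∷ l} {c} x≢c y≢c (first q) rewrite ∷-∖-≢ l x≢c = first (∈-∖⁺ q y≢c)
before-∖ {l = z ∷ l} {c} x≢c y≢c (later q) with z ≟ c
... | yes _ = before-∖ x≢c y≢c q
... | no _ = later (before-∖ x≢c y≢c q)

-- If `c` is absent from `l` it is added, so that `firstOccurrences` can treat new and repeated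
-- letters alike.
moveToFront : Fin n → List (Fin n) → List (Fin n)
moveToFront c l = c ∷ l ∖ c

-- Only comparisons with `c` as the larger letter can be destroyed by the move.
before-moveToFront : {l : List (Fin n)} {c x y : Fin n} → y ≢ c → Before l x y →
                     Before (moveToFront c l) x y
before-moveToFront {c = c} {x} y≢c q with x ≟ c
... | yes refl = first (∈-∖⁺ (before-∈ʳ q) y≢c)
... | no x≢c = later (before-∖ x≢c y≢c q)

moveToFront-↭ : {l : List (Fin n)} {c : Fin n} → Unique l → c ∈ l → moveToFront c l ↭ l
moveToFront-↭ {c = c} u c∈l with l , r , refl ← ∈-∃++ c∈l =
  ↭-trans (↭-reflexive (cong (c ∷_) removed)) (↭-sym (shift c l r))
  where
  c∉ : All (c ≢_) (l ++ r)
  c∉ with x ∷ _ ← unique-resp-↭ (shift c l r) u = x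
  c∉lr : c ∉ l ++ r
  c∉lr p = All.lookup c∉ p refl
  removed : (l ++ c ∷ r) ∖ c ≡ l ++ r
  removed = begin
    (l ++ c ∷ r) ∖ c      ≡⟨ ++-∖ l (c ∷ r) c ⟩
    l ∖ c ++ (c ∷ r) ∖ c  ≡⟨ cong₂ _++_ (∖-∉ (c∉lr ∘ ∈-++⁺ˡ)) (trans (∷-∖-≡ c r) (∖-∉ (c∉lr ∘ ∈-++⁺ʳ l))) ⟩
    l ++ r                ∎
    where open ≡-Reasoning

-- Built from the right end of the word: prepending `c` makes it first and deletes its later entry.
-- By `order-step`, the orders of the conjugates obey the same recursion.
firstOccurrences : List (Fin n) → List (Fin n)
firstOccurrences [] = []
firstOccurrences (c ∷ s) = moveToFront c (firstOccurrences s)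

∈-firstOccurrences⁺ : {s : List (Fin n)} {x : Fin n} → x ∈ s → x ∈ firstOccurrences s
∈-firstOccurrences⁺ (here refl) = here refl
∈-firstOccurrences⁺ {s = c ∷ s} {x} (there p) with x ≟ c
... | yes refl = here refl
... | no x≢c = there (∈-∖⁺ (∈-firstOccurrences⁺ p) x≢c)

∈-firstOccurrences⁻ : (s : List (Fin n)) {x : Fin n} → x ∈ firstOccurrences s → x ∈ s
∈-firstOccurrences⁻ (c ∷ s) (here refl) = here refl
∈-firstOccurrences⁻ (c ∷ s) (there p) = there (∈-firstOccurrences⁻ s (proj₁ (∈-∖⁻ p)))

-- A letter outside `s` is never moved when letters of `s` are prepended, so it stays last.
firstOccurrences-∷ʳ : (s : List (Fin n)) {a : Fin n} → a ∉ s →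
                      firstOccurrences (s ++ [ a ]) ≡ firstOccurrences s ++ [ a ]
firstOccurrences-∷ʳ [] _ = refl
firstOccurrences-∷ʳ (c ∷ s) {a} a∉ = cong (c ∷_) (begin
  firstOccurrences (s ++ [ a ]) ∖ c       ≡⟨ cong (_∖ c) (firstOccurrences-∷ʳ s (a∉ ∘ there)) ⟩
  (firstOccurrences s ++ [ a ]) ∖ c       ≡⟨ ++-∖ (firstOccurrences s) [ a ] c ⟩
  firstOccurrences s ∖ c ++ [ a ] ∖ c     ≡⟨ cong (firstOccurrences s ∖ c ++_) (∷-∖-≢ [] (λ { refl → a∉ (here refl) })) ⟩
  firstOccurrences s ∖ c ++ [ a ]         ∎)
  where open ≡-Reasoning

-- From strict total orders to lists

allPairs-before : {R : Rel A 0ℓ} {l : List A} {x y : A} → AllPairs R l → Before l x y → R x y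
allPairs-before (r ∷ _) (first q) = All.lookup r q
allPairs-before (_ ∷ rs) (later q) = allPairs-before rs q

-- Turns an order given as a relation into a permutation of the alphabet; permutations can be
-- counted and compared by equality.
sortedList : {_<_ : Rel (Fin n) 0ℓ} → IsStrictTotalOrder _≡_ _<_ →
             ∃[ σ ] (σ ↭ allFin n × (∀ {x y} → x < y → Before σ x y))
sortedList {n} {_<_} sto = sort (allFin n) , sort-↭ (allFin n) , before
  where
  O = STO.decTotalOrder (record { Carrier = Fin n; isStrictTotalOrder = sto })
  open Sort O
  open IsStrictTotalOrder sto using (irrefl; asym)
  sorted = Linked⇒AllPairs (DecTotalOrder.trans O) (sort-↗ (allFin n))
  member : ∀ x → x ∈ sort (allFin n)
  member x = ∈-resp-↭ (↭-sym (sort-↭ (allFin n))) (∈-allFin x)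
  before : ∀ {x y} → x < y → Before (sort (allFin n)) x y
  before {x} {y} x<y with before-total (member x) (member y) (λ x≡y → irrefl x≡y x<y)
  ... | inj₁ q = q
  ... | inj₂ q with allPairs-before sorted q
  ...   | inj₁ y<x = contradiction y<x (asym x<y)
  ...   | inj₂ y≡x = contradiction x<y (irrefl (sym y≡x))

-- Cyclic words as periodic sequences of letters

module Sequence {n : ℕ} (W : ℕ → Fin n) where

  -- Compares the infinite sequences starting at `i` and `j`. A derivation is finite, so it always
  -- exhibits a first mismatch.
  data Less (_<_ : Rel (Fin n) 0ℓ) : ℕ → ℕ → Set where
    here  : ∀ {i j} → W i < W j → Less _<_ i j
    there : ∀ {i j} → W i ≡ W j → Less _<_ (suc i) (suc j) → Less _<_ i j

  less-map : {R S : Rel (Fin n) 0ℓ} {i j : ℕ} → (∀ {x y} → R x y → S x y) → Less R i j → Less S i j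
  less-map f (here r) = here (f r)
  less-map f (there e l) = there e (less-map f l)

  less-asym : {l : List (Fin n)} {i j : ℕ} → Unique l → Less (Before l) i j → ¬ Less (Before l) j i
  less-asym u (here p) (here q) = before-asym u p q
  less-asym u (here p) (there e _) = before-irrefl u (subst (Before _ _) e p)
  less-asym u (there e _) (here q) = before-irrefl u (subst (Before _ _) e q)
  less-asym u (there _ p) (there _ q) = less-asym u p q

  -- The hypothesis on the order ρ guarantees that c is not the larger letter at the first mismatch.
  less-moveToFront : {ρ σ : List (Fin n)} {c : Fin n} → Unique ρ → Unique σ → (∀ k → ¬ Before ρ (W k) c) →
                     {i j : ℕ} → Less (Before ρ) i j → Less (Before σ) i j →
                     Less (Before (moveToFront c σ)) i j
  less-moveToFront _ _ c-min {i} (here p) (here q) =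
    here (before-moveToFront (λ y≡c → c-min i (subst (Before _ _) y≡c p)) q)
  less-moveToFront u _ _ (here p) (there e _) = contradiction (subst (Before _ _) (sym e) p) (before-irrefl u)
  less-moveToFront _ v _ (there e _) (here q) = contradiction (subst (Before _ _) (sym e) q) (before-irrefl v)
  less-moveToFront u v c-min (there e p) (there _ q) = there e (less-moveToFront u v c-min p q)

  Occurs : ℕ → List (Fin n) → Set
  Occurs i [] = ⊤
  Occurs i (c ∷ s) = W i ≡ c × Occurs (suc i) s

  occurs-∷ʳ : ∀ {i} s → Occurs i s → ∃[ d ] Occurs i (s ++ [ d ])
  occurs-∷ʳ {i} [] _ = W i , refl , tt
  occurs-∷ʳ (_ ∷ s) (e , o) = let d , o′ = occurs-∷ʳ s o in d , e , o′

  occurs-prefix : ∀ {i} s {t} → Occurs i (s ++ t) → Occurs i s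
  occurs-prefix [] _ = tt
  occurs-prefix (_ ∷ s) (e , o) = e , occurs-prefix s o

  -- Both derivations end at the same first mismatch. If it fell within `s`, the letter there on the
  -- side of `i` would belong to `s` and be the smaller one under `ρ` but the larger one under `σ`,
  -- against the agreement of the two orders.
  less-occurs : {ρ σ : List (Fin n)} {i j : ℕ} → Unique ρ → Unique σ →
                Less (Before ρ) i j → Less (Before σ) j i →
                ∀ s → (∀ {x y} → x ∈ s → Before ρ x y → ¬ Before σ y x) →
                Occurs i s → Occurs j s
  less-occurs u v _ _ [] _ _ = tt
  less-occurs u v (here p) (here q) (_ ∷ s) agree (refl , o) = contradiction q (agree (here refl) p)
  less-occurs u v (here p) (there e _) (_ ∷ s) _ _ = contradiction (subst (Before _ _) e p) (before-irrefl u)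
  less-occurs u v (there e _) (here q) (_ ∷ s) _ _ = contradiction (subst (Before _ _) e q) (before-irrefl v)
  less-occurs u v (there e p) (there _ q) (_ ∷ s) agree (refl , o) =
    sym e , less-occurs u v p q s (agree ∘ there) o

  -- Within the common `s` a mismatch would relate a letter to itself, so the first mismatch is `x`
  -- against `y`.
  less-∷ʳ : {R : Rel (Fin n) 0ℓ} {i j : ℕ} {x y : Fin n} → x ≢ y → Less R i j →
            ∀ s → Irreflexive _≡_ R → Occurs i (s ++ [ x ]) → Occurs j (s ++ [ y ]) → R x y
  less-∷ʳ x≢y (here r) [] _ (refl , _) (refl , _) = r
  less-∷ʳ x≢y (there e _) [] _ (e₁ , _) (e₂ , _) = contradiction (trans (sym e₁) (trans e e₂)) x≢y
  less-∷ʳ x≢y (here r) (_ ∷ s) irrefl (e₁ , _) (e₂ , _) = contradiction r (irrefl (trans e₁ (sym e₂)))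
  less-∷ʳ x≢y (there _ l) (_ ∷ s) irrefl (_ , o₁) (_ , o₂) = less-∷ʳ x≢y l s irrefl o₁ o₂

  occurs-last-unique : ∀ {i x y} s → Occurs i (s ++ [ x ]) → Occurs i (s ++ [ y ]) → x ≡ y
  occurs-last-unique [] (e₁ , _) (e₂ , _) = trans (sym e₁) e₂
  occurs-last-unique (_ ∷ s) (_ , o₁) (_ , o₂) = occurs-last-unique s o₁ o₂

  segment : ℕ → ℕ → List (Fin n)
  segment i zero = []
  segment i (suc k) = W i ∷ segment (suc i) k

  length-segment : ∀ i k → length (segment i k) ≡ k
  length-segment i zero = refl
  length-segment i (suc k) = cong suc (length-segment (suc i) k)

  segment-+ : ∀ i j k → segment i (j + k) ≡ segment i j ++ segment (i + j) k
  segment-+ i zero k = cong (λ m → segment m k) (sym (ℕ.+-identityʳ i))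
  segment-+ i (suc j) k = cong (W i ∷_)
    (trans (segment-+ (suc i) j k) (cong (λ m → segment (suc i) j ++ segment m k) (sym (ℕ.+-suc i j))))

  segment-unique : ∀ l k → (∀ i → lookup l i ≡ W (k + toℕ i)) → l ≡ segment k (length l)
  segment-unique [] k _ = refl
  segment-unique (x ∷ l) k eq = cong₂ _∷_
    (trans (eq Fin.zero) (cong W (ℕ.+-identityʳ k)))
    (segment-unique l (suc k) (λ i → trans (eq (Fin.suc i)) (cong W (ℕ.+-suc k (toℕ i)))))

  segment⇒occurs : ∀ i s → s ≡ segment i (length s) → Occurs i s
  segment⇒occurs i [] _ = tt
  segment⇒occurs i (c ∷ s) eq = sym (∷-injectiveˡ eq) , segment⇒occurs (suc i) s (∷-injectiveʳ eq)

  occurs⇒segment : ∀ i s → Occurs i s → s ≡ segment i (length s)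
  occurs⇒segment i [] _ = refl
  occurs⇒segment i (c ∷ s) (e , o) = cong₂ _∷_ (sym e) (occurs⇒segment (suc i) s o)

  -- Equal lengths exclude `prefix`, so a mismatch among the first `k` letters decides, and it
  -- decides for the infinite sequences too.
  lex⇒less : {R : Rel (Fin n) 0ℓ} → ∀ i j k {u v} → Lex R u v →
             u ≡ segment i k → v ≡ segment j k → Less R i j
  lex⇒less i j zero prefix _ ()
  lex⇒less i j (suc k) prefix () _
  lex⇒less i j (suc k) (here r) refl refl = here r
  lex⇒less i j (suc k) (there l) p q = there
    (trans (sym (∷-injectiveˡ p)) (∷-injectiveˡ q))
    (lex⇒less (suc i) (suc j) k l (∷-injectiveʳ p) (∷-injectiveʳ q))

++-injective-length : (x x′ : List A) {y y′ : List A} → length x ≡ length x′ →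
                      x ++ y ≡ x′ ++ y′ → x ≡ x′ × y ≡ y′
++-injective-length [] [] _ eq = refl , eq
++-injective-length (_ ∷ x) (_ ∷ x′) len eq =
  let x≡x′ , y≡y′ = ++-injective-length x x′ (ℕ.suc-injective len) (∷-injectiveʳ eq)
  in cong₂ _∷_ (∷-injectiveˡ eq) x≡x′ , y≡y′

-- Positions of a universal Lyndon word and its conjugates

module UniversalLyndon (n : ℕ) (w : List (Fin n)) (universal : IsUniversalLyndon n w) where

  N : ℕ
  N = n !

  instance
    N≢0 : NonZero N
    N≢0 = n !≢0

  length-w : length w ≡ N
  length-w = proj₁ universal

  infix 4 _~_
  -- Positions stay unreduced, so that the next one is always `suc`; congruent positions start the
  -- same conjugate.
  _~_ : ℕ → ℕ → Set
  i ~ j = i % N ≡ j % N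

  class : ℕ → Fin N
  class i = fromℕ< (m%n<n i N)

  class-cong : ∀ {i j} → i ~ j → class i ≡ class j
  class-cong {i} {j} i~j = fromℕ<-cong (i % N) (j % N) i~j (m%n<n i N) (m%n<n j N)

  class-injective : ∀ {i j} → class i ≡ class j → i ~ j
  class-injective {i} {j} = fromℕ<-injective (i % N) (j % N) (m%n<n i N) (m%n<n j N)

  W : ℕ → Fin n
  W i = lookup w (fromℕ< (subst (i % N <_) (sym length-w) (m%n<n i N)))

  W-cong : ∀ {i j} → i ~ j → W i ≡ W j
  W-cong {i} {j} i~j = cong (lookup w) (fromℕ<-cong (i % N) (j % N) i~j _ _)

  lookup-w : ∀ i → lookup w i ≡ W (toℕ i)
  lookup-w i = cong (lookup w) (toℕ-injective (sym (trans (toℕ-fromℕ< _)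
    (m<n⇒m%n≡m (subst (toℕ i <_) length-w (toℕ<n i))))))

  open Sequence W

  ~-+ʳ : ∀ {i j} k → i ~ j → i + k ~ j + k
  ~-+ʳ {i} {j} k i~j = begin
    (i + k) % N              ≡⟨ %-distribˡ-+ i k N ⟩
    (i % N + k % N) % N      ≡⟨ cong (λ m → (m + k % N) % N) i~j ⟩
    (j % N + k % N) % N      ≡⟨ %-distribˡ-+ j k N ⟨
    (j + k) % N              ∎
    where open ≡-Reasoning

  ~-+ˡ : ∀ {i j} k → i ~ j → k + i ~ k + j
  ~-+ˡ {i} {j} k i~j = subst₂ _~_ (ℕ.+-comm i k) (ℕ.+-comm j k) (~-+ʳ k i~j)

  ~-period : ∀ i → i + N ~ i
  ~-period i = [m+n]%n≡m%n i N

  %-~ : ∀ i → i % N ~ i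
  %-~ i = m%n%n≡m%n i N

  suc-+-pred : ∀ i → suc i + pred N ≡ i + N
  suc-+-pred i = trans (sym (ℕ.+-suc i _)) (cong (i +_) (ℕ.suc-pred N))

  ~-pred : ∀ {i j} → suc i ~ suc j → i ~ j
  ~-pred {i} {j} e = begin
    i % N                       ≡⟨ ~-period i ⟨
    (i + N) % N                 ≡⟨ cong (_% N) (suc-+-pred i) ⟨
    (suc i + pred N) % N      ≡⟨ ~-+ʳ (pred N) e ⟩
    (suc j + pred N) % N      ≡⟨ cong (_% N) (suc-+-pred j) ⟩
    (j + N) % N                 ≡⟨ ~-period j ⟩
    j % N                       ∎
    where open ≡-Reasoning

  ~-predecessor : ∀ i → ∃[ j ] suc j ~ i
  -- Adding `pred N` goes back one position modulo `N`, from position 0 as well.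
  ~-predecessor i = i + pred N , trans (cong (_% N) (suc-+-pred i)) (~-period i)

  less-resp-~ : {R : Rel (Fin n) 0ℓ} → ∀ {i i′ j j′} → i ~ i′ → j ~ j′ → Less R i j → Less R i′ j′
  less-resp-~ {R} p q (here r) = here (subst₂ R (W-cong p) (W-cong q) r)
  less-resp-~ p q (there e l) =
    there (trans (sym (W-cong p)) (trans e (W-cong q))) (less-resp-~ (~-+ˡ 1 p) (~-+ˡ 1 q) l)

  occurs-resp-~ : ∀ {i j} s → i ~ j → Occurs i s → Occurs j s
  occurs-resp-~ [] _ _ = tt
  occurs-resp-~ (_ ∷ s) p (e , o) = trans (sym (W-cong p)) e , occurs-resp-~ s (~-+ˡ 1 p) o

  segment-cong : ∀ {i j} k → i ~ j → segment i k ≡ segment j k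
  segment-cong zero _ = refl
  segment-cong (suc k) p = cong₂ _∷_ (W-cong p) (segment-cong k (~-+ˡ 1 p))

  w≡segment : w ≡ segment 0 N
  w≡segment = trans (segment-unique w 0 lookup-w) (cong (segment 0) length-w)

  ww≡segment : w ++ w ≡ segment 0 (N + N)
  ww≡segment = begin
    w ++ w                        ≡⟨ cong₂ _++_ w≡segment w≡segment ⟩
    segment 0 N ++ segment 0 N    ≡⟨ cong (segment 0 N ++_) (segment-cong N (sym (~-period 0))) ⟩
    segment 0 N ++ segment N N    ≡⟨ segment-+ 0 N N ⟨
    segment 0 (N + N)             ∎
    where open ≡-Reasoning

  segment-split : ∀ i d {e} → d + e ≡ N → segment i N ≡ segment i d ++ segment (i + d) e
  segment-split i d {e} d+e≡N = trans (cong (segment i) (sym d+e≡N)) (segment-+ i d e)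

  segment-rotate : ∀ i {d e} → d + e ≡ N → segment (i + d) e ++ segment i d ≡ segment (i + d) N
  segment-rotate i {d} {e} d+e≡N = begin
    segment (i + d) e ++ segment i d              ≡⟨ cong (segment (i + d) e ++_) (segment-cong d (sym wrap)) ⟩
    segment (i + d) e ++ segment (i + d + e) d    ≡⟨ segment-+ (i + d) e d ⟨
    segment (i + d) (e + d)                       ≡⟨ cong (segment (i + d)) (trans (ℕ.+-comm e d) d+e≡N) ⟩
    segment (i + d) N                             ∎
    where
    open ≡-Reasoning
    wrap : i + d + e ~ i
    wrap = trans (cong (_% N) (trans (ℕ.+-assoc i d e) (cong (i +_) d+e≡N))) (~-period i)

  -- Chosen once for each residue, so that congruent positions will receive the very same list.
  conjugate-order : (k : Fin N) → ∃[ σ ] (σ ↭ allFin n × (∀ j → ¬ toℕ k ~ j → Less (Before σ) (toℕ k) j))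
  conjugate-order k = let σ , σ↭ , before = sortedList (proj₁ (proj₂ lyndon)) in
    σ , σ↭ , λ j k≁j → less-map before (less j k≁j)
    where
    r = toℕ k
    r+ : r + (N ∸ r) ≡ N
    r+ = ℕ.m+[n∸m]≡n (ℕ.<⇒≤ (toℕ<n k))
    lyndon : IsLyndon (segment r N)
    lyndon = subst IsLyndon (segment-rotate 0 r+)
      (proj₂ universal (segment 0 r) (segment r (N ∸ r)) (trans w≡segment (segment-split 0 r r+)))
    _≺_ = proj₁ lyndon
    less : ∀ j → ¬ r ~ j → Less _≺_ r j
    less j r≁j = less-resp-~ refl target
      (lex⇒less r (r + d) N
        (proj₂ (proj₂ lyndon) (segment r d) (segment (r + d) (N ∸ d))
          (nonempty d≢0) (nonempty (ℕ.m>n⇒m∸n≢0 d<N)) (segment-split r d d+))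
        refl (segment-rotate r d+))
      where
      -- The forward distance from `r` to `j`: adding `N ∸ r` subtracts `r` modulo `N`. It is
      -- nonzero as `r` and `j` are incongruent, so the conjugate at `j` is a proper conjugate of
      -- the one at `r`.
      d = (j + (N ∸ r)) % N
      d<N : d < N
      d<N = m%n<n (j + (N ∸ r)) N
      d+ : d + (N ∸ d) ≡ N
      d+ = ℕ.m+[n∸m]≡n (ℕ.<⇒≤ d<N)
      target : r + d ~ j
      target = begin
        (r + d) % N                  ≡⟨ ~-+ˡ r (%-~ (j + (N ∸ r))) ⟩
        (r + (j + (N ∸ r))) % N      ≡⟨ cong (_% N) (ℕ.+-comm r (j + (N ∸ r))) ⟩
        (j + (N ∸ r) + r) % N        ≡⟨ cong (_% N) (ℕ.+-assoc j (N ∸ r) r) ⟩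
        (j + (N ∸ r + r)) % N        ≡⟨ cong (λ m → (j + m) % N) (trans (ℕ.+-comm (N ∸ r) r) r+) ⟩
        (j + N) % N                  ≡⟨ ~-period j ⟩
        j % N                        ∎
        where open ≡-Reasoning
      d≢0 : d ≢ 0
      d≢0 d≡0 = r≁j (trans (cong (_% N) (sym (trans (cong (r +_) d≡0) (ℕ.+-identityʳ r)))) target)
      nonempty : ∀ {i m} → m ≢ 0 → segment i m ≢ []
      nonempty {m = zero} m≢0 _ = m≢0 refl

  -- The bijection between conjugates and orders

  abstract
    order : ℕ → List (Fin n)
    order i = proj₁ (conjugate-order (class i))

    order-cong : ∀ {i j} → i ~ j → order i ≡ order j
    order-cong i~j = cong (proj₁ ∘ conjugate-order) (class-cong i~j)

    order-↭ : ∀ i → order i ↭ allFin n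
    order-↭ i = proj₁ (proj₂ (conjugate-order (class i)))

    order-unique : ∀ i → Unique (order i)
    order-unique i = unique-resp-↭ (↭-sym (order-↭ i)) (allFin⁺ n)

    ∈-order : ∀ i x → x ∈ order i
    ∈-order i x = ∈-resp-↭ (↭-sym (order-↭ i)) (∈-allFin x)

    order-less : ∀ {i j} → ¬ i ~ j → Less (Before (order i)) i j
    order-less {i} {j} i≁j = less-resp-~ k~i refl
      (proj₂ (proj₂ (conjugate-order (class i))) j (λ k~j → i≁j (trans (sym k~i) k~j)))
      where
      k~i : toℕ (class i) ~ i
      k~i = trans (cong (_% N) (toℕ-fromℕ< (m%n<n i N))) (%-~ i)

  -- If `i` and `j` were incongruent, each of the two conjugates would be smaller than the other
  -- under `σ`, which is the order at `j`.
  minimal⇒order : ∀ {i σ} → (∀ j → ¬ i ~ j → Less (Before σ) i j) → ∀ {j} → order j ≡ σ → i ~ j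
  minimal⇒order {i} minimal {j} refl with i % N ℕ.≟ j % N
  ... | yes i~j = i~j
  ... | no i≁j = contradiction (order-less (i≁j ∘ sym)) (less-asym (order-unique j) (minimal j i≁j))

  order-injective : ∀ {i j} → order i ≡ order j → i ~ j
  order-injective {i} eq = minimal⇒order (λ _ → order-less) (sym eq)

  -- The `N` residues have distinct permutations of the alphabet as orders, and `N` is the number of
  -- all permutations.
  order-surjective : ∀ {σ} → σ ↭ allFin n → ∃[ i ] order i ≡ σ
  order-surjective {σ} σ↭ =
    let k , eq = ∈-tabulate⁻ (unique-⊆-⊇ unique included len (∈-permutations (allFin n) σ↭))
    in toℕ k , sym eq
    where
    unique : Unique (tabulate (order ∘ toℕ {N}))
    unique = tabulate⁺ (λ {i} {j} eq → toℕ-injective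
      (trans (sym (m<n⇒m%n≡m (toℕ<n i))) (trans (order-injective eq) (m<n⇒m%n≡m (toℕ<n j)))))
    included : ∀ {τ} → τ ∈ tabulate (order ∘ toℕ {N}) → τ ∈ permutations (allFin n)
    included τ∈ with k , refl ← ∈-tabulate⁻ τ∈ = ∈-permutations (allFin n) (order-↭ (toℕ k))
    len : length (permutations (allFin n)) ≤ length (tabulate (order ∘ toℕ {N}))
    len = ℕ.≤-reflexive (trans (length-permutations (allFin n))
      (trans (cong _! (length-tabulate {n = n} (λ i → i))) (sym (length-tabulate (order ∘ toℕ {N})))))

  -- Orders at consecutive positions, and the factors read off from them

  first-minimal : ∀ i k → ¬ Before (order i) (W k) (W i)
  first-minimal i k q with order-less {i} {k} (λ i~k → before-irrefl (order-unique i) (subst (Before _ _) (W-cong i~k) q))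
  ... | here r = before-asym (order-unique i) q r
  ... | there e _ = before-irrefl (order-unique i) (subst (Before _ _) e q)

  order-moveToFront-↭ : ∀ c i → moveToFront c (order i) ↭ allFin n
  order-moveToFront-↭ c i = ↭-trans (moveToFront-↭ (order-unique i) (∈-order i c)) (order-↭ i)

  order-step : ∀ i → order i ≡ moveToFront (W i) (order (suc i))
  -- Some position `j` has the new list as its order; `minimal` forces it to be congruent to `i`.
  order-step i = let j , eq = order-surjective (order-moveToFront-↭ (W i) (suc i))
             in trans (order-cong (minimal⇒order minimal eq)) eq
    where
    minimal : ∀ j → ¬ i ~ j → Less (Before (moveToFront (W i) (order (suc i)))) i j
    minimal j i≁j with W j ≟ W i | order-less i≁j
    ... | no Wj≢Wi | _ = here (first (∈-∖⁺ (∈-order (suc i) (W j)) Wj≢Wi))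
    ... | yes Wj≡Wi | here q = contradiction (subst (Before _ _) Wj≡Wi q) (before-irrefl (order-unique i))
    -- The tails are compared both under `order i` and under `order (suc i)`. The first comparison
    -- shows, by `first-minimal`, that `W i` is not the larger letter at the mismatch, so the second
    -- one survives moving `W i` to the front.
    ... | yes _ | there e l = there e
      (less-moveToFront (order-unique i) (order-unique (suc i)) (first-minimal i) l (order-less (i≁j ∘ ~-pred)))

  -- Iterating `order-step` along `s` reproduces the recursion of `firstOccurrences`; what follows
  -- `s` only influences `τ`.
  occurs⇒order : ∀ {i} s → Occurs i s → ∃[ τ ] order i ≡ firstOccurrences s ++ τ
  occurs⇒order {i} [] _ = order i , refl
  occurs⇒order {i} (c ∷ s) (refl , o) =
    let τ , eq = occurs⇒order s o in
    τ ∖ c , trans (order-step i) (trans (cong (moveToFront c) eq) (cong (c ∷_) (++-∖ (firstOccurrences s) τ c)))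

  -- The orders at `i` and `j` share an initial segment containing all letters of `s`. A letter
  -- preceding one of these in either order lies in that segment too, so the orders agree there and
  -- `less-occurs` carries `s` from `i` to `j`.
  order⇒occurs : ∀ {i j} s {τ} → Occurs i s → order j ≡ firstOccurrences s ++ τ → Occurs j s
  order⇒occurs {i} {j} s {τ} o fj with i % N ℕ.≟ j % N | occurs⇒order s o
  ... | yes i~j | _ = occurs-resp-~ s i~j o
  ... | no i≁j | υ , fi =
    less-occurs (order-unique i) (order-unique j) (order-less i≁j) (order-less (i≁j ∘ sym)) s agree o
    where
    agree : ∀ {x y} → x ∈ s → Before (order i) x y → ¬ Before (order j) y x
    agree x∈s p q = before-asym (order-unique i) p
      (subst (λ l → Before l _ _) (sym fi) (before-++ˡ υ
        (before-++⁻ˡ (firstOccurrences s) (subst Unique fj (order-unique j)) (∈-firstOccurrences⁺ x∈s)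
          (subst (λ l → Before l _ _) fj q))))

  moveToFront-++ : ∀ {i c} p {τ} → order i ≡ p ++ τ → c ∈ p → moveToFront c (order i) ≡ moveToFront c p ++ τ
  moveToFront-++ {i} {c} p {τ} fi c∈p = cong (c ∷_) (begin
    order i ∖ c          ≡⟨ cong (_∖ c) fi ⟩
    (p ++ τ) ∖ c     ≡⟨ ++-∖ p τ c ⟩
    p ∖ c ++ τ ∖ c   ≡⟨ cong (p ∖ c ++_) (∖-∉ c∉τ) ⟩
    p ∖ c ++ τ       ∎)
    where
    open ≡-Reasoning
    c∉τ : c ∉ τ
    c∉τ c∈τ = before-irrefl (subst Unique fi (order-unique i)) (before-++⁺ c∈p c∈τ)

  -- Prepending c ∈ s loses no information about the order, so the
  -- orders starting with s all come from occurrences of c ∷ s.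
  preceding-letter : ∀ {k y c} s → c ∈ s → Occurs k (c ∷ s) → Occurs (suc y) s → W y ≡ c
  preceding-letter {k} {y} {c} s c∈s ok oy =
    let p = firstOccurrences s
        c∈p = ∈-firstOccurrences⁺ c∈s
        τ , fy = occurs⇒order s oy
        m , fm = order-surjective (order-moveToFront-↭ c (suc y))
        fm′ = trans fm (moveToFront-++ p fy c∈p)
        Wm≡c , om = order⇒occurs (c ∷ s) ok fm′
        υ , fsm = occurs⇒order s om
        fm″ = trans (order-step m) (trans (cong (λ d → moveToFront d (order (suc m))) Wm≡c) (moveToFront-++ p fsm c∈p))
        -- Moving `c` to the front turns both `order (suc m)` and `order (suc y)` into `order m` and
        -- leaves what follows `p` intact. So the two orders are equal, and `m` and `y` are
        -- congruent.
        υ≡τ = ++-cancelˡ (moveToFront c p) υ τ (trans (sym fm″) fm′)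
        m~y = ~-pred (order-injective (trans fsm (trans (cong (p ++_) υ≡τ) (sym fy))))
    in trans (sym (W-cong m~y)) Wm≡c

  -- From `asa` to `bsb`

  module _ (s : List (Fin n)) {a b : Fin n} (a∉s : a ∉ s) (b∉s : b ∉ s) (b≢a : b ≢ a)
           {i : ℕ} (asa : Occurs i (a ∷ s ++ [ a ])) where

    private
      p : List (Fin n)
      p = firstOccurrences s

      s-at-i : Occurs (suc i) s
      s-at-i = occurs-prefix s (proj₂ asa)

      -- An occurrence of `s` is represented by the position just before it, whose order shows the
      -- preceding letter `c` in front of `p`.
      _⟶_ : ℕ → ℕ → Set
      y ⟶ z = ∃₂ λ c τ → order y ≡ c ∷ p ++ τ × order (suc z) ≡ p ++ c ∷ τ

      order-surjective-suc : ∀ {σ} → σ ↭ allFin n → ∃[ z ] order (suc z) ≡ σ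
      order-surjective-suc σ↭ =
        let j , fj = order-surjective σ↭
            z , sz~j = ~-predecessor j
        in z , trans (order-cong sz~j) fj

      step : ∀ y → Occurs (suc y) s → ∃[ z ] (Occurs (suc z) s × y ⟶ z)
      step y o =
        let τ , fsy = occurs⇒order s o
            fy = trans (order-step y) (cong (W y ∷_) (trans (cong (_∖ W y) fsy)
                   (trans (++-∖ p τ (W y)) (cong (_++ τ ∖ W y) (∖-∉ Wy∉p)))))
            z , fsz = order-surjective-suc (↭-trans (shift (W y) p (τ ∖ W y))
                        (↭-trans (↭-reflexive (sym fy)) (order-↭ y)))
        in z , order⇒occurs s s-at-i fsz , W y , τ ∖ W y , fy , fsz
        where
        Wy∉p : W y ∉ p
        -- Otherwise `W y` would lie in `s` and hence precede every occurrence of `s`, including the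
        -- one inside `asa`, so that `a` would be in `s`.
        Wy∉p Wy∈p = a∉s (subst (_∈ s) (trans (sym Wi≡Wy) (proj₁ asa)) Wy∈s)
          where
          Wy∈s = ∈-firstOccurrences⁻ s Wy∈p
          Wi≡Wy = preceding-letter s Wy∈s (refl , o) s-at-i

      -- As `p` is fixed, the list `p ++ c ∷ τ` determines `c` and `τ`, hence `order y`.
      ⟶-injective : ∀ {y y′ z z′} → y ⟶ z → y′ ⟶ z′ → class z ≡ class z′ → class y ≡ class y′
      ⟶-injective {z = z} {z′} (c , τ , fy , fsz) (c′ , τ′ , fy′ , fsz′) eq
        with refl ← ++-cancelˡ p (c ∷ τ) (c′ ∷ τ′)
               (trans (sym fsz) (trans (order-cong (~-+ˡ 1 (class-injective {z} {z′} eq))) fsz′))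
        = class-cong (order-injective (trans fy (sym fy′)))

      order-at-i : ∃[ τ ] order (suc i) ≡ p ++ a ∷ τ
      order-at-i = let τ , eq = occurs⇒order (s ++ [ a ]) (proj₂ asa) in
        τ , trans eq (trans (cong (_++ τ) (firstOccurrences-∷ʳ s a∉s)) (++-assoc p [ a ] τ))

      -- The position sought is a predecessor under `_⟶_` of some `x` whose successor has an order
      -- beginning with `p`, `b`, `a`. Such an `x` comes from the order at `suc i` by moving `b` to
      -- the front of the part after `p`.
      b-first : ∃₂ λ y ρ → Occurs (suc y) s × order y ≡ b ∷ p ++ a ∷ ρ
      b-first =
        let τ , fsi = order-at-i
            uτ = unique-++ʳ p (subst Unique fsi (order-unique (suc i)))
            x , fsx = order-surjective-suc (↭-trans
                        (++⁺ˡ p (moveToFront-↭ uτ (b-rest τ fsi)))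
                        (↭-trans (↭-reflexive (sym fsi)) (order-↭ (suc i))))
            fsx′ = trans fsx (cong (λ l → p ++ b ∷ l) (∷-∖-≢ τ (b≢a ∘ sym)))
            y , z , oy , (c , υ , fy , fsz) , z≡x =
              predecessor class (λ y → Occurs (suc y) s) _⟶_ step ⟶-injective x (order⇒occurs s s-at-i fsx)
            eq = ++-cancelˡ p (c ∷ υ) (b ∷ a ∷ τ ∖ b)
                   (trans (sym fsz) (trans (order-cong (~-+ˡ 1 (class-injective {z} {x} z≡x))) fsx′))
        in y , τ ∖ b , oy , trans fy (cong₂ (λ d l → d ∷ p ++ l) (∷-injectiveˡ eq) (∷-injectiveʳ eq))
        where
        b-rest : ∀ τ → order (suc i) ≡ p ++ a ∷ τ → b ∈ a ∷ τ
        b-rest τ eq with ∈-++⁻ p (subst (b ∈_) eq (∈-order (suc i) b))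
        ... | inj₁ b∈p = contradiction (∈-firstOccurrences⁻ s b∈p) b∉s
        ... | inj₂ b∈τ = b∈τ

      Wy≡b : ∀ {y ρ} → order y ≡ b ∷ p ++ a ∷ ρ → W y ≡ b
      Wy≡b {y} fy = ∷-injectiveˡ (trans (sym (order-step y)) fy)

    return : ∃[ y ] Occurs y (b ∷ s ++ [ b ])
    return =
      let y , ρ , oy , fy = b-first
          d , od = occurs-∷ʳ s oy
      in y , Wy≡b fy , subst (λ d → Occurs (suc y) (s ++ [ d ])) (next y ρ oy fy d od) od
      where
      next : ∀ y ρ → Occurs (suc y) s → order y ≡ b ∷ p ++ a ∷ ρ → ∀ d → Occurs (suc y) (s ++ [ d ]) → d ≡ b
      next y ρ oy fy d od with d ≟ b | d ≟ a
      ... | yes d≡b | _ = d≡b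
      -- With `d` equal to `a`, the factor `s ++ [ a ]` would be preceded by `b` here but by `a` at
      -- `i`, although it contains `a`.
      ... | no _ | yes refl = contradiction
        (trans (sym (Wy≡b fy)) (preceding-letter (s ++ [ a ]) (∈-++⁺ʳ s (here refl)) asa od)) b≢a
      ... | no d≢b | no d≢a = contradiction d-before-a not-before
        where
        oa = proj₂ asa
        fsi = proj₂ order-at-i

        sy≁si : ¬ suc y ~ suc i
        sy≁si sy~si = d≢a (occurs-last-unique s (occurs-resp-~ (s ++ [ d ]) sy~si od) oa)

        irrefl : ∀ k → Irreflexive _≡_ (Before (order k))
        irrefl k refl = before-irrefl (order-unique k)

        -- At `suc i` the factor `s` is followed by `a`, at `suc y` by `d`; so `a` comes before `d`
        -- in `order (suc i)`, where all of `p` comes before `a`.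
        d∉p : d ∉ p
        d∉p d∈p = before-asym (order-unique (suc i))
          (less-∷ʳ (d≢a ∘ sym) (order-less (sy≁si ∘ sym)) s (irrefl (suc i)) oa od)
          (subst (λ l → Before l d a) (sym fsi) (before-++⁺ d∈p (here refl)))

        -- The reverse comparison puts `d` before `a` in `order (suc y)`. Deleting `W y` leaves
        -- `p ++ a ∷ ρ`, and `d` is not in `p`, so it would have to precede the head `a` of the
        -- rest.
        d-before-a : Before (a ∷ ρ) d a
        d-before-a = before-++⁻ʳ p d∉p (subst (λ l → Before l d a)
          (∷-injectiveʳ (trans (sym (order-step y)) fy))
          (before-∖ (λ d≡Wy → d≢b (trans d≡Wy (Wy≡b fy))) (λ a≡Wy → b≢a (sym (trans a≡Wy (Wy≡b fy))))
            (less-∷ʳ d≢a (order-less sy≁si) s (irrefl (suc y)) od oa)))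

        unique-aρ : Unique (a ∷ ρ)
        unique-aρ = unique-++ʳ (b ∷ p) (subst Unique fy (order-unique y))

        not-before : ¬ Before (a ∷ ρ) d a
        not-before (first _) = d≢a refl
        not-before (later q) with a∉ρ ∷ _ ← unique-aρ = All.lookup a∉ρ (before-∈ʳ q) refl

  -- Cyclic factors of the word and occurrences in the periodic sequence

  cyclicFactor⇒occurs : ∀ {u} → CyclicFactor u w → ∃[ i ] Occurs i u
  cyclicFactor⇒occurs {u} (_ , _ , x , y , ww) = length x , segment⇒occurs (length x) u u≡segment
    where
    open ≡-Reasoning
    lengths : N + N ≡ length x + (length u + length y)
    lengths = begin
      N + N                                  ≡⟨ cong₂ _+_ length-w length-w ⟨
      length w + length w                    ≡⟨ length-++ w ⟨
      length (w ++ w)                        ≡⟨ cong length ww ⟩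
      length (x ++ u ++ y)                   ≡⟨ length-++ x ⟩
      length x + length (u ++ y)             ≡⟨ cong (length x +_) (length-++ u) ⟩
      length x + (length u + length y)       ∎
    split : x ++ u ++ y ≡ segment 0 (length x) ++ segment (length x) (length u) ++ segment (length x + length u) (length y)
    split = begin
      x ++ u ++ y                                      ≡⟨ ww ⟨
      w ++ w                                           ≡⟨ ww≡segment ⟩
      segment 0 (N + N)                                ≡⟨ cong (segment 0) lengths ⟩
      segment 0 (length x + (length u + length y))     ≡⟨ segment-+ 0 (length x) _ ⟩
      segment 0 (length x) ++ segment (length x) (length u + length y)
        ≡⟨ cong (segment 0 (length x) ++_) (segment-+ (length x) (length u) (length y)) ⟩
      segment 0 (length x) ++ segment (length x) (length u) ++ segment (length x + length u) (length y) ∎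
    u≡segment : u ≡ segment (length x) (length u)
    u≡segment = proj₁ (++-injective-length u _ (sym (length-segment (length x) (length u)))
      (proj₂ (++-injective-length x (segment 0 (length x)) (sym (length-segment 0 (length x))) split)))

  -- Reducing the position modulo `N` makes it less than `N`; as `u` has length at most `N`, it then
  -- ends within the first `N + N` letters, which form `w ++ w`.
  occurs⇒cyclicFactor : ∀ {i u} → u ≢ [] → length u ≤ length w → Occurs i u → CyclicFactor u w
  occurs⇒cyclicFactor {i} {u} u≢[] u≤w o = u≢[] , u≤w , segment 0 r , segment (r + length u) e , (begin
    w ++ w                                       ≡⟨ ww≡segment ⟩
    segment 0 (N + N)                            ≡⟨ cong (segment 0) (sym lengths) ⟩
    segment 0 (r + (length u + e))               ≡⟨ segment-+ 0 r _ ⟩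
    segment 0 r ++ segment r (length u + e)      ≡⟨ cong (segment 0 r ++_) (segment-+ r (length u) e) ⟩
    segment 0 r ++ segment r (length u) ++ segment (r + length u) e
      ≡⟨ cong (λ v → segment 0 r ++ v ++ segment (r + length u) e) (occurs⇒segment r u (occurs-resp-~ u (sym (%-~ i)) o)) ⟨
    segment 0 r ++ u ++ segment (r + length u) e ∎)
    where
    open ≡-Reasoning
    r = i % N
    e = N + N ∸ (r + length u)
    lengths : r + (length u + e) ≡ N + N
    lengths = trans (sym (ℕ.+-assoc r (length u) e))
      (ℕ.m+[n∸m]≡n (ℕ.+-mono-≤ (ℕ.<⇒≤ (m%n<n i N)) (subst (length u ≤_) length-w u≤w)))

theorem3 : (n : ℕ) (w s : List (Fin n)) (a : Fin n) → IsUniversalLyndon n w → a ∉ s → CyclicFactor (a ∷ s ++ [ a ]) w → (b : Fin n) → b ∉ s → CyclicFactor (b ∷ s ++ [ b ]) w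
theorem3 n w s a universal a∉s asa b b∉s with b ≟ a
... | yes refl = asa
... | no b≢a =
  let i , asa-at-i = cyclicFactor⇒occurs asa
      y , bsb-at-y = return s a∉s b∉s b≢a asa-at-i
  -- The length bound for `bsb` is inherited from `asa`, which has the same length.
  in occurs⇒cyclicFactor (λ ()) (subst (_≤ length w) same-length (proj₁ (proj₂ asa))) bsb-at-y
  where
  open UniversalLyndon n w universal
  same-length : length (a ∷ s ++ [ a ]) ≡ length (b ∷ s ++ [ b ])
  same-length = cong suc (trans (length-++ s) (sym (length-++ s)))
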